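{- The flattening operator $\mathsf F$ increases the expressive power of unary anonymity logic $\mathrm{FO}(\Upsilon_1)$; that is, there is a formula of $\mathrm{FO}(\Upsilon_1,\mathsf F)$ that is not equivalent to any formula of $\mathrm{FO}(\Upsilon_1)$.
   Context: A team $X$ over a model $\mathfrak M$ with non-empty domain $M$ is a set of assignments $s:\mathrm{dom}(X)\to M$ with a common set of variables $\mathrm{dom}(X)$. $s[m/v]$ is the assignment sending $v$ to $m$ and agreeing with $s$ otherwise; $X[M/v]=\{s[m/v]: s\in X, m\in M\}$; for $H:X\to\mathcal P(M)\setminus\{\varnothing\}$, $X[H/v]=\{s[m/v]: s\in X, m\in H(s)\}$. $\mathrm{FO}(\Upsilon_1)$-formulas are built from first-order literals and anonymity atoms $\vec t_1\Upsilon t_2$ with $\vec t_1$ a tuple of at most one term, $t_2$ a term, using $\land,\lor,\exists,\forall$; $\mathrm{FO}(\Upsilon_1,\mathsf F)$ additionally allows the unary operator $\mathsf F$. Team semantics: - literals: $\mathfrak M\models_X\alpha$ iff $\mathfrak M\models_s\alpha$ (Tarski) for all $s\in X$; - $\mathfrak M\models_X\vec t_1\Upsilon t_2$ iff for all $s\in X$ there is $s'\in X$ with $s(\vec t_1)=s'(\vec t_1)$ and $s(t_2)\neq s'(t_2)$; - $\mathfrak M\models_X\psi_1\lor\psi_2$ iff $X=Y\cup Z$ for some (not necessarily disjoint) $Y,Z$ with $\mathfrak M\models_Y\psi_1$, $\mathfrak M\models_Z\psi_2$; - $\mathfrak M\models_X\psi_1\land\psi_2$ iff $\mathfrak M\models_X\psi_1$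 and $\mathfrak M\models_X\psi_2$; - $\mathfrak M\models_X\exists v\psi$ iff $\mathfrak M\models_{X[H/v]}\psi$ for some $H:X\to\mathcal P(M)\setminus\{\varnothing\}$; - $\mathfrak M\models_X\forall v\psi$ iff $\mathfrak M\models_{X[M/v]}\psi$; - $\mathfrak M\models_X\mathsf F\psi$ iff $\mathfrak M\models_{\{s\}}\psi$ for all $s\in X$. Two formulas are equivalent if they are satisfied by the same models $\mathfrak M$ and teams $X$ over $\mathfrak M$ (whose domain contains the free variables of both). -}

module Defs where

open import Data.Maybe using (Maybe; just; nothing)
import Data.Maybe as Maybe
open import Data.Nat using (ℕ; _≟_)
open import Data.Product using (Σ-syntax; ∃-syntax; _×_; _,_)
open import Data.Vec using (Vec; []; _∷_)
open import Function.Bundles using (_⇔_)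
open import Level using (0ℓ; Lift) renaming (suc to lsuc)
open import Relation.Binary.PropositionalEquality using (_≡_; _≢_; sym; trans)
open import Relation.Nullary using (¬_; yes; no)
open import Relation.Unary using (Pred; _∈_; _⊆_; _≐_; _∪_; _∖_; ∅; ｛_｝)

Var : Set
Var = ℕ

record Signature : Set₁ where
  field
    Rel  : Set
    relA : Rel → ℕ
    Fun  : Set
    funA : Fun → ℕ

data Logic : Set where
  FO[Υ₁] FO[Υ₁,F] : Logic

module _ (σ : Signature) where
  open Signature σ

  data Term : Set where
    var : Var → Term
    fn  : (f : Fun) → Vec Term (funA f) → Term

  infixr 6 _∧'_
  infixr 5 _∨'_

  data Formula : Logic → Set where
    rel nrel : ∀ {ℒ} (R : Rel) → Vec Term (relA R) → Formula ℒ
    eq neq   : ∀ {ℒ} → Term → Term → Formula ℒ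
    -- `nothing` is the empty tuple of terms.
    anon     : ∀ {ℒ} → Maybe Term → Term → Formula ℒ
    _∧'_ _∨'_ : ∀ {ℒ} → Formula ℒ → Formula ℒ → Formula ℒ
    ∃' ∀'    : ∀ {ℒ} → Var → Formula ℒ → Formula ℒ
    flat     : Formula FO[Υ₁,F] → Formula FO[Υ₁,F]

  record Model : Set₁ where
    field
      M     : Set
      point : M
      ⟦_⟧ʳ  : (R : Rel) → Vec M (relA R) → Set
      ⟦_⟧ᶠ  : (f : Fun) → Vec M (funA f) → M

module _ {σ : Signature} where

  FVᵗ  : Term σ → Pred Var 0ℓ
  FVᵗˢ : ∀ {n} → Vec (Term σ) n → Pred Var 0ℓ
  FVᵗ (var v)   = ｛ v ｝
  FVᵗ (fn _ ts) = FVᵗˢ ts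
  FVᵗˢ []       = ∅
  FVᵗˢ (t ∷ ts) = FVᵗ t ∪ FVᵗˢ ts

  FV : ∀ {ℒ} → Formula σ ℒ → Pred Var 0ℓ
  FV (rel _ ts)        = FVᵗˢ ts
  FV (nrel _ ts)       = FVᵗˢ ts
  FV (eq t u)          = FVᵗ t ∪ FVᵗ u
  FV (neq t u)         = FVᵗ t ∪ FVᵗ u
  FV (anon nothing u)  = FVᵗ u
  FV (anon (just t) u) = FVᵗ t ∪ FVᵗ u
  FV (φ ∧' ψ)          = FV φ ∪ FV ψ
  FV (φ ∨' ψ)          = FV φ ∪ FV ψ
  FV (∃' v ψ)          = FV ψ ∖ ｛ v ｝
  FV (∀' v ψ)          = FV ψ ∖ ｛ v ｝
  FV (flat ψ)          = FV ψ

-- An assignment with domain D is represented by any of its extensions to a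
-- total function (M is non-empty in every model); functions that agree on D
-- represent the same assignment.
Assignment : Set → Set
Assignment M = Var → M

infix 4 _≈[_]_
_≈[_]_ : ∀ {M} → Assignment M → Pred Var 0ℓ → Assignment M → Set
s ≈[ D ] s' = ∀ v → v ∈ D → s v ≡ s' v

_[_/_] : ∀ {M} → Assignment M → M → Var → Assignment M
(s [ m / v ]) w with w ≟ v
... | yes _ = m
... | no  _ = s w

-- `resp` makes `set` a set of assignments with domain D, rather than of
-- their total representatives.
record Team (M : Set) (D : Pred Var 0ℓ) : Set₁ where
  field
    set  : Pred (Assignment M) 0ℓ
    resp : ∀ {s s'} → s ≈[ D ] s' → s ∈ set → s' ∈ set
open Team public

-- Functions X → 𝒫(M) ∖ {∅}; the values of `H` outside X are irrelevant.
record Choice {M : Set} {D : Pred Var 0ℓ} (X : Team M D) : Set₁ where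
  field
    H        : Assignment M → Pred M 0ℓ
    H-resp   : ∀ {s s' m} → s ∈ set X → s ≈[ D ] s' → m ∈ H s → m ∈ H s'
    nonempty : ∀ {s} → s ∈ set X → ∃[ m ] m ∈ H s
open Choice public

module _ {M : Set} {D : Pred Var 0ℓ} where

  singleton : Assignment M → Team M D
  singleton s = record
    { set  = λ s' → s' ≈[ D ] s
    ; resp = λ e p v d → trans (sym (e v d)) (p v d)
    }

  _[_/ᴴ_] : (X : Team M D) → Choice X → (v : Var) → Team M (D ∪ ｛ v ｝)
  X [ C /ᴴ v ] = record
    { set  = λ s' → ∃[ s ] ∃[ m ] s ∈ set X × m ∈ H C s
                      × s' ≈[ D ∪ ｛ v ｝ ] (s [ m / v ])
    ; resp = λ { e (s , m , p , h , q) →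
                 s , m , p , h , λ w d → trans (sym (e w d)) (q w d) }
    }

  _[M/_] : Team M D → (v : Var) → Team M (D ∪ ｛ v ｝)
  X [M/ v ] = record
    { set  = λ s' → ∃[ s ] ∃[ m ] s ∈ set X × s' ≈[ D ∪ ｛ v ｝ ] (s [ m / v ])
    ; resp = λ { e (s , m , p , q) →
                 s , m , p , λ w d → trans (sym (e w d)) (q w d) }
    }

module _ {σ : Signature} (𝔐 : Model σ) where
  open Model 𝔐

  eval  : Assignment M → Term σ → M
  evals : ∀ {n} → Assignment M → Vec (Term σ) n → Vec M n
  eval s (var v)   = s v
  eval s (fn f ts) = ⟦ f ⟧ᶠ (evals s ts)
  evals s []       = []
  evals s (t ∷ ts) = eval s t ∷ evals s ts

infix 4 _⊨[_]_
-- Meaningful only for teams whose domain contains the free variables of the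
-- formula.
_⊨[_]_ : ∀ {σ D ℒ} (𝔐 : Model σ) → Team (Model.M 𝔐) D → Formula σ ℒ → Set₁
𝔐 ⊨[ X ] rel R ts  = Lift (lsuc 0ℓ) (∀ s → s ∈ set X → Model.⟦_⟧ʳ 𝔐 R (evals 𝔐 s ts))
𝔐 ⊨[ X ] nrel R ts = Lift (lsuc 0ℓ) (∀ s → s ∈ set X → ¬ Model.⟦_⟧ʳ 𝔐 R (evals 𝔐 s ts))
𝔐 ⊨[ X ] eq t u    = Lift (lsuc 0ℓ) (∀ s → s ∈ set X → eval 𝔐 s t ≡ eval 𝔐 s u)
𝔐 ⊨[ X ] neq t u   = Lift (lsuc 0ℓ) (∀ s → s ∈ set X → eval 𝔐 s t ≢ eval 𝔐 s u)
𝔐 ⊨[ X ] anon t u  = Lift (lsuc 0ℓ) (∀ s → s ∈ set X → ∃[ s' ] s' ∈ set X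
                       × Maybe.map (eval 𝔐 s) t ≡ Maybe.map (eval 𝔐 s') t
                       × eval 𝔐 s u ≢ eval 𝔐 s' u)
𝔐 ⊨[ X ] (φ ∧' ψ)  = 𝔐 ⊨[ X ] φ × 𝔐 ⊨[ X ] ψ
_⊨[_]_ {D = D} 𝔐 X (φ ∨' ψ) =
  Σ[ Y ∈ Team (Model.M 𝔐) D ] Σ[ Z ∈ Team (Model.M 𝔐) D ]
    set X ≐ set Y ∪ set Z × 𝔐 ⊨[ Y ] φ × 𝔐 ⊨[ Z ] ψ
𝔐 ⊨[ X ] ∃' v ψ    = Σ[ C ∈ Choice X ] 𝔐 ⊨[ X [ C /ᴴ v ] ] ψ
𝔐 ⊨[ X ] ∀' v ψ    = 𝔐 ⊨[ X [M/ v ] ] ψ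
_⊨[_]_ {D = D} 𝔐 X (flat ψ) =
  ∀ s → s ∈ set X → 𝔐 ⊨[ singleton {D = D} s ] ψ

Equivalent : ∀ {σ ℒ ℒ'} → Formula σ ℒ → Formula σ ℒ' → Set₁
Equivalent {σ} φ ψ =
  (𝔐 : Model σ) (D : Pred Var 0ℓ) → FV φ ⊆ D → FV ψ ⊆ D →
  (X : Team (Model.M 𝔐) D) → 𝔐 ⊨[ X ] φ ⇔ 𝔐 ⊨[ X ] ψ

-- Take the structure (ℤ, b = a + 2).  On a singleton team θ says that some set of
-- integers contains x₀, is closed under ± 2 and omits x₁; this holds if x₁ - x₀ is odd
-- and fails if it is even.  So flat θ holds of the team of all pairs at odd distance and
-- fails as soon as a pair at even distance is added.
-- A formula ψ of FO[Υ₁] cannot see distances beyond some K, by an Ehrenfeucht–Fraïssé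
-- argument: ψ passes from X to X' whenever every s' ∈ X' agrees with some s ∈ X on
-- all differences of size at most K, and X' contains every translate of X.  The
-- translates take care of the anonymity atoms.  If s' agrees with s ∈ X, and r ∈ X has
-- r(x) = s(x) and r(y) ≠ s(y), translate by s'(x) - s(x): both s and r then give x the
-- value s'(x), and since they give y different values, at least one of those is not s'(y).
module Submission where

open import Defs
open import Data.Empty using (⊥)
open import Data.Integer using (ℤ; +_; -[1+_]; _+_; _-_; -_; ∣_∣; 0ℤ)
import Data.Integer.Properties as ℤ
open import Algebra.Properties.AbelianGroup ℤ.+-0-abelianGroup
  using () renaming (∙-cancelˡ to +-cancelˡ; ∙-cancelʳ to +-cancelʳ)
open import Data.Integer.Tactic.RingSolver using (solve-∀)
open import Data.Maybe using (just; nothing)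
import Data.Maybe as Maybe
open import Data.Maybe.Properties using (just-injective)
open import Data.Nat as ℕ using (ℕ; zero; suc; _⊔_; _≤_; _<_)
import Data.Nat.Properties as ℕ
open import Data.Product using (Σ-syntax; ∃-syntax; _×_; _,_; proj₁; proj₂)
open import Data.Sum as Sum using (_⊎_; inj₁; inj₂)
open import Data.Unit using (⊤; tt)
open import Data.Vec using ([]; _∷_)
open import Function.Bundles using (Equivalence)
open import Level using (0ℓ; lift)
open import Relation.Binary.PropositionalEquality
  using (_≡_; _≢_; refl; sym; trans; cong; subst; subst₂; module ≡-Reasoning)
open import Relation.Nullary using (¬_; yes; no; contradiction)
open import Relation.Unary using (Pred; U; _∈_; _⊆_; _∪_; ｛_｝)

-- The structure and the separating formula.

σ : Signature
σ = record { Rel = ⊤ ; relA = λ _ → 2 ; Fun = ⊥ ; funA = λ () }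

+2-graph : Model σ
+2-graph = record
  { M     = ℤ
  ; point = 0ℤ
  ; ⟦_⟧ʳ  = λ { _ (a ∷ b ∷ []) → b ≡ a + + 2 }
  ; ⟦_⟧ᶠ  = λ ()
  }

-- The set meant consists of the values of x₂ in the right disjunct, which must take in x₂ = x₀. As
-- x₂ is x₃ or x₃ + 2, the first anonymity atom forces both x₂ and x₂ - 2 as values of x₃, the
-- second both x₃ and x₃ + 2 as values of x₂.
θ : Formula σ FO[Υ₁,F]
θ = ∀' 2 (neq (var 2) (var 0) ∨'
      ∃' 3 (anon (just (var 2)) (var 3) ∧' anon (just (var 3)) (var 2) ∧'
            neq (var 2) (var 1) ∧'
            (eq (var 2) (var 3) ∨' rel tt (var 3 ∷ var 2 ∷ []))))

-- The variables and distances that a formula can inspect.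

boundᵗ : Term σ → ℕ
boundᵗ (var v) = suc v

-- Quantified variables count where they occur in atoms, so one N serves the whole induction.
bound : Formula σ FO[Υ₁] → ℕ
bound (rel _ (t ∷ u ∷ []))  = boundᵗ t ⊔ boundᵗ u
bound (nrel _ (t ∷ u ∷ [])) = boundᵗ t ⊔ boundᵗ u
bound (eq t u)              = boundᵗ t ⊔ boundᵗ u
bound (neq t u)             = boundᵗ t ⊔ boundᵗ u
bound (anon nothing u)      = boundᵗ u
bound (anon (just t) u)     = boundᵗ t ⊔ boundᵗ u
bound (φ ∧' ψ)              = bound φ ⊔ bound ψ
bound (φ ∨' ψ)              = bound φ ⊔ bound ψ
bound (∃' _ ψ)              = bound ψ
bound (∀' _ ψ)              = bound ψ


-- Differences up to this size can be inspected: an atom sees a + 2, and a quantifier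
-- doubles the range since two points can be compared through a third.
radius : Formula σ FO[Υ₁] → ℕ
radius (φ ∧' ψ) = radius φ ⊔ radius ψ
radius (φ ∨' ψ) = radius φ ⊔ radius ψ
radius (∃' _ ψ) = radius ψ ℕ.+ radius ψ
radius (∀' _ ψ) = radius ψ ℕ.+ radius ψ
radius _        = 2

-- Beyond K not even signs are compared, so any far point can answer any other.
Agree : ℕ → ℤ → ℤ → Set
Agree K d d' = ∣ d ∣ ≤ K ⊎ ∣ d' ∣ ≤ K → d ≡ d'

Agree-sym : ∀ {K d d'} → Agree K d d' → Agree K d' d
Agree-sym a p = sym (a (Sum.swap p))

Agree-weaken : ∀ {K L d d'} → K ≤ L → Agree L d d' → Agree K d d'
Agree-weaken K≤L a = λ p → a (Sum.map (λ q → ℕ.≤-trans q K≤L) (λ q → ℕ.≤-trans q K≤L) p)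

Agree-flip : ∀ {K} a b a' b' → Agree K (a - b) (a' - b') → Agree K (b - a) (b' - a')
Agree-flip a b a' b' h p = begin
  b - a       ≡⟨ flip a b ⟩
  - (a - b)   ≡⟨ cong -_ (h (Sum.map (∣flip∣ a b) (∣flip∣ a' b') p)) ⟩
  - (a' - b') ≡⟨ flip a' b' ⟨
  b' - a'     ∎
  where
  open ≡-Reasoning
  flip : ∀ x y → y - x ≡ - (x - y)
  flip = solve-∀
  ∣flip∣ : ∀ {K} x y → ∣ y - x ∣ ≤ K → ∣ x - y ∣ ≤ K
  ∣flip∣ {K} x y = subst (_≤ K) (ℤ.∣i-j∣≡∣j-i∣ y x)

-- By the triangle inequality, d has size at most K + K once e and e + d have size at most K. This
-- is the source of the doubling in `radius`.
Agree-translate : ∀ {K d d'} e → ∣ e ∣ ≤ K → Agree (K ℕ.+ K) d d' → Agree K (e + d) (e + d')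
Agree-translate {K} {d} {d'} e ∣e∣≤K a p = cong (_+_ e) (a (Sum.map (widen d) (widen d') p))
  where
  cancel : ∀ x y → (x + y) - x ≡ y
  cancel = solve-∀
  widen : ∀ d → ∣ e + d ∣ ≤ K → ∣ d ∣ ≤ K ℕ.+ K
  widen d q = subst (λ z → ∣ z ∣ ≤ K ℕ.+ K) (cancel e d)
    (ℕ.≤-trans (ℤ.∣i-j∣≤∣i∣+∣j∣ (e + d) e) (ℕ.+-mono-≤ q ∣e∣≤K))

Agree-offset : ∀ {K a b a' b'} c → ∣ c ∣ ≤ K → Agree K (b - a) (b' - a') →
               b ≡ a + c → b' ≡ a' + c
Agree-offset {K} {a} {_} {a'} {b'} c ∣c∣≤K h refl = begin
  b'               ≡⟨ split a' b' ⟩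
  a' + (b' - a')   ≡⟨ cong (_+_ a') (h (inj₁ (subst (λ z → ∣ z ∣ ≤ K) (sym (cancel a c)) ∣c∣≤K))) ⟨
  a' + (a + c - a) ≡⟨ cong (_+_ a') (cancel a c) ⟩
  a' + c           ∎
  where
  open ≡-Reasoning
  cancel : ∀ x y → (x + y) - x ≡ y
  cancel = solve-∀
  split : ∀ x y → y ≡ x + (y - x)
  split = solve-∀

-- Back-and-forth between assignments.

record Near (N K : ℕ) (s s' : Assignment ℤ) : Set where
  constructor near
  field
    agree : ∀ {i j} → i < N → j < N → Agree K (s j - s i) (s' j - s' i)
open Near

Near-weaken : ∀ {N K L s s'} → K ≤ L → Near N L s s' → Near N K s s'
Near-weaken K≤L n .agree p q = Agree-weaken K≤L (n .agree p q)

Near-sym : ∀ {N K s s'} → Near N K s s' → Near N K s' s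
Near-sym n .agree p q = Agree-sym (n .agree p q)

Near-respʳ : ∀ {N K s s' s''} → (∀ v → s' v ≡ s'' v) → Near N K s s' → Near N K s s''
Near-respʳ e n .agree {i} {j} p q rewrite sym (e i) | sym (e j) = n .agree p q

shift : ℤ → Assignment ℤ → Assignment ℤ
shift c s v = s v + c

Near-shift : ∀ {N K} s c → Near N K s (shift c s)
Near-shift s c .agree {i} {j} _ _ _ = sym (cancel (s j) (s i) c)
  where
  cancel : ∀ x y c → (x + c) - (y + c) ≡ x - y
  cancel = solve-∀

shift-update : ∀ s c m v w → shift c (s [ m / v ]) w ≡ (shift c s [ m + c / v ]) w
shift-update s c m v w with w ℕ.≟ v
... | yes _ = refl
... | no  _ = refl

Near-update : ∀ {N K s s' m m'} v → Near N K s s' →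
              (∀ {j} → j < N → Agree K (m - s j) (m' - s' j)) →
              Near N K (s [ m / v ]) (s' [ m' / v ])
Near-update {s = s} {s'} {m} {m'} v n a .agree {i} {j} p q with i ℕ.≟ v | j ℕ.≟ v
... | yes _ | yes _ = λ _ → trans (ℤ.+-inverseʳ m) (sym (ℤ.+-inverseʳ m'))
... | yes _ | no  _ = Agree-flip m (s j) m' (s' j) (a q)
... | no  _ | yes _ = a p
... | no  _ | no  _ = n .agree p q

bounded-values : ∀ N (s : Assignment ℤ) → ∃[ B ] (∀ {j} → j < N → ∣ s j ∣ ≤ B)
bounded-values zero    s = 0 , λ ()
bounded-values (suc N) s with bounded-values N s
... | B , b = B ⊔ ∣ s N ∣ , λ j<1+N → bound-step (ℕ.m<1+n⇒m<n∨m≡n j<1+N)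
  where
  bound-step : ∀ {j} → j < N ⊎ j ≡ N → ∣ s j ∣ ≤ B ⊔ ∣ s N ∣
  bound-step (inj₁ j<N)  = ℕ.≤-trans (b j<N) (ℕ.m≤m⊔n B _)
  bound-step (inj₂ refl) = ℕ.m≤n⊔m B _

-- The point lies K + 1 beyond a bound on finitely many values; hence the cut-off N in `Near`.
far-point : ∀ N K (s : Assignment ℤ) → ∃[ m ] (∀ {j} → j < N → K < ∣ m - s j ∣)
far-point N K s with bounded-values N s
... | B , b = + (suc K ℕ.+ B) , λ {j} j<N → ℕ.+-cancelʳ-≤ B _ _ (begin
  suc K ℕ.+ B                                     ≡⟨⟩
  ∣ + (suc K ℕ.+ B) ∣                             ≡⟨ cong ∣_∣ (split (+ (suc K ℕ.+ B)) (s j)) ⟩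
  ∣ (+ (suc K ℕ.+ B) - s j) + s j ∣               ≤⟨ ℤ.∣i+j∣≤∣i∣+∣j∣ (+ (suc K ℕ.+ B) - s j) (s j) ⟩
  ∣ + (suc K ℕ.+ B) - s j ∣ ℕ.+ ∣ s j ∣           ≤⟨ ℕ.+-monoʳ-≤ _ (b j<N) ⟩
  ∣ + (suc K ℕ.+ B) - s j ∣ ℕ.+ B                 ∎)
  where
  open ℕ.≤-Reasoning
  split : ∀ x y → x ≡ (x - y) + y
  split = solve-∀

-- The game step. If m is within K of some `s i`, the answer has the same offset from `s' i`, and
-- the other differences are compared through i. Otherwise a point far from all values of s' will
-- do.
Near-extend : ∀ {N K s s'} → Near N (K ℕ.+ K) s s' → ∀ v m →
              ∃[ m' ] Near N K (s [ m / v ]) (s' [ m' / v ])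
Near-extend {N} {K} {s} {s'} n v m
  with ℕ.anyUpTo? (λ i → ∣ m - s i ∣ ℕ.≤? K) N
... | yes (i , i<N , close) = m' , Near-update v (Near-weaken (ℕ.m≤m+n K K) n) linked
  where
  m' = s' i + (m - s i)
  via₁ : ∀ a b c → (a - b) + (b - c) ≡ a - c
  via₁ = solve-∀
  via₂ : ∀ e b c → e + (b - c) ≡ (b + e) - c
  via₂ = solve-∀
  linked : ∀ {j} → j < N → Agree K (m - s j) (m' - s' j)
  linked {j} j<N = subst₂ (Agree K) (via₁ m (s i) (s j)) (via₂ (m - s i) (s' i) (s' j))
    (Agree-translate (m - s i) close (n .agree j<N i<N))
... | no ¬close with far-point N K s'
... | m' , far = m' , Near-update v (Near-weaken (ℕ.m≤m+n K K) n) λ j<N → λ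
  { (inj₁ close) → contradiction (_ , j<N , close) ¬close
  ; (inj₂ close) → contradiction close (ℕ.<⇒≱ (far j<N)) }

-- Covering of teams under splitting and quantifiers.

Full : Pred Var 0ℓ → Set
Full D = ∀ v → v ∈ D

-- The relation between X and X' that preserves FO[Υ₁]-formulas.  Closure of X' under
-- all assignments near X would be too much: it is lost under ∃.
record Covers {D} (N K : ℕ) (X X' : Team ℤ D) : Set where
  field
    approx : ∀ {s'} → s' ∈ set X' → ∃[ s ] s ∈ set X × Near N K s s'
    shifts : ∀ {s} c → s ∈ set X → shift c s ∈ set X'
open Covers

Covers-weaken : ∀ {D N K L} {X X' : Team ℤ D} → K ≤ L → Covers N L X X' → Covers N K X X'
Covers-weaken K≤L cov .approx s'∈X' with cov .approx s'∈X'
... | s , s∈X , n = s , s∈X , Near-weaken K≤L n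
Covers-weaken K≤L cov .shifts = cov .shifts

-- Membership in X' is demanded because X' need not contain everything near Y, and the images of a
-- split of X must make up exactly X'.
image : ∀ {D} → Full D → (N K : ℕ) (Y X' : Team ℤ D) → Team ℤ D
image full N K Y X' .set s' = s' ∈ set X' × ∃[ s ] s ∈ set Y × Near N K s s'
image full N K Y X' .resp e (s'∈X' , s , s∈Y , n) =
  resp X' e s'∈X' , s , s∈Y , Near-respʳ (λ v → e v (full v)) n

Covers-image : ∀ {D N K} {X X' Y : Team ℤ D} (full : Full D) → Covers N K X X' →
               set Y ⊆ set X → Covers N K Y (image full N K Y X')
Covers-image full cov Y⊆X .approx (_ , s∈Y) = s∈Y
Covers-image full cov Y⊆X .shifts {s} c s∈Y =
  cov .shifts c (Y⊆X s∈Y) , s , s∈Y , Near-shift s c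

module _ {D N K} {X X' : Team ℤ D} (full : Full D) (v : Var)
         (cov : Covers N (K ℕ.+ K) X X') where

  Near-shift-update : ∀ s m c → Near N K (s [ m / v ]) (shift c s [ m + c / v ])
  Near-shift-update s m c = Near-respʳ (shift-update s c m v) (Near-shift (s [ m / v ]) c)

  shift-resp : ∀ {p s m} c → p ≈[ D ∪ ｛ v ｝ ] (s [ m / v ]) →
               shift c p ≈[ D ∪ ｛ v ｝ ] (shift c s [ m + c / v ])
  shift-resp {s = s} {m} c e w w∈ = trans (cong (_+ c) (e w w∈)) (shift-update s c m v w)

  Covers-∀ : Covers N K (X [M/ v ]) (X' [M/ v ])
  Covers-∀ .approx {p'} (s' , m' , s'∈X' , e) with cov .approx s'∈X'
  -- The new value is given on the side of X', so the game is played back from s' to s.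
  ... | s , s∈X , n with Near-extend (Near-sym n) v m'
  ... | m , n' = s [ m / v ] , (s , m , s∈X , λ _ _ → refl) ,
                 Near-respʳ (λ w → sym (e w (inj₁ (full w)))) (Near-sym n')
  Covers-∀ .shifts c (s , m , s∈X , e) =
    shift c s , m + c , cov .shifts c s∈X , shift-resp c e

  -- The largest choice that keeps `approx`. At `shift c s` it contains m + c for each m chosen at
  -- s, which keeps `shifts`.
  image-choice : Choice X → Choice X'
  image-choice C .H s' m' = ∃[ s ] ∃[ m ]
    s ∈ set X × m ∈ H C s × Near N K (s [ m / v ]) (s' [ m' / v ])
  image-choice C .H-resp {s'} {s''} {m'} _ e (s , m , s∈X , m∈H , n) =
    s , m , s∈X , m∈H , Near-respʳ update-cong n
    where
    update-cong : ∀ w → (s' [ m' / v ]) w ≡ (s'' [ m' / v ]) w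
    update-cong w with w ℕ.≟ v
    ... | yes _ = refl
    ... | no  _ = e w (full w)
  image-choice C .nonempty s'∈X' with cov .approx s'∈X'
  ... | s , s∈X , n with nonempty C s∈X
  ... | m , m∈H with Near-extend n v m
  ... | m' , n' = m' , s , m , s∈X , m∈H , n'

  Covers-∃ : (C : Choice X) → Covers N K (X [ C /ᴴ v ]) (X' [ image-choice C /ᴴ v ])
  Covers-∃ C .approx (s' , m' , s'∈X' , (s , m , s∈X , m∈H , n) , e) =
    s [ m / v ] , (s , m , s∈X , m∈H , λ _ _ → refl) ,
    Near-respʳ (λ w → sym (e w (inj₁ (full w)))) n
  Covers-∃ C .shifts c (s , m , s∈X , m∈H , e) =
    shift c s , m + c , cov .shifts c s∈X ,
    (s , m , s∈X , m∈H , Near-shift-update s m c) , shift-resp c e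

-- Preservation of formulas.

module _ {D N K} {X X' : Team ℤ D} (cov : Covers N K X X') where

  literal : ∀ (P : ℤ → ℤ → Set) {i j} → i < N → j < N →
            (∀ {a b a' b'} → Agree K (b - a) (b' - a') → P a b → P a' b') →
            (∀ s → s ∈ set X → P (s i) (s j)) → ∀ s → s ∈ set X' → P (s i) (s j)
  literal P i<N j<N stable p s' s'∈X' with cov .approx s'∈X'
  ... | s , s∈X , n = stable (n .agree i<N j<N) (p s s∈X)


Agree-E : ∀ {K a b a' b'} → 2 ≤ K → Agree K (b - a) (b' - a') → b ≡ a + + 2 → b' ≡ a' + + 2
Agree-E = Agree-offset (+ 2)

Agree-≡ : ∀ {K a b a' b'} → Agree K (b - a) (b' - a') → a ≡ b → a' ≡ b'
Agree-≡ {a = a} {a' = a'} h refl =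
  sym (trans (Agree-offset 0ℤ ℕ.z≤n h (sym (ℤ.+-identityʳ a))) (ℤ.+-identityʳ a'))

transfer : ∀ {D N K} (ψ : Formula σ FO[Υ₁]) {X X' : Team ℤ D} →
           Full D → bound ψ ≤ N → radius ψ ≤ K → Covers N K X X' →
           +2-graph ⊨[ X ] ψ → +2-graph ⊨[ X' ] ψ
transfer (rel _ (var i ∷ var j ∷ [])) full b r cov (lift p) =
  lift (literal cov (λ a b → b ≡ a + + 2)
    (ℕ.m⊔n≤o⇒m≤o (suc i) (suc j) b) (ℕ.m⊔n≤o⇒n≤o (suc i) _ b) (Agree-E r) p)
transfer (nrel _ (var i ∷ var j ∷ [])) full b r cov (lift p) =
  lift (literal cov (λ a b → b ≢ a + + 2)
    (ℕ.m⊔n≤o⇒m≤o (suc i) (suc j) b) (ℕ.m⊔n≤o⇒n≤o (suc i) _ b)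
    (λ h ¬e e → ¬e (Agree-E r (Agree-sym h) e)) p)
transfer (eq (var i) (var j)) full b r cov (lift p) =
  lift (literal cov _≡_
    (ℕ.m⊔n≤o⇒m≤o (suc i) (suc j) b) (ℕ.m⊔n≤o⇒n≤o (suc i) _ b) Agree-≡ p)
transfer (neq (var i) (var j)) full b r cov (lift p) =
  lift (literal cov _≢_
    (ℕ.m⊔n≤o⇒m≤o (suc i) (suc j) b) (ℕ.m⊔n≤o⇒n≤o (suc i) _ b)
    (λ h ¬e e → ¬e (Agree-≡ (Agree-sym h) e)) p)
transfer (anon nothing (var y)) full b r cov (lift p) = lift disagree
  where
  move : ∀ a a' → a + (+ 1 + (a' - a)) ≡ + 1 + a'
  move = solve-∀
  disagree : ∀ s' → _ → _
  disagree s' s'∈X' with cov .approx s'∈X'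
  ... | s , s∈X , _ = shift c s , cov .shifts c s∈X , refl ,
        λ e → ℤ.i≢suc[i] (trans e (move (s y) (s' y)))
    -- The translate by c gives y the value s' y + 1.
    where c = + 1 + (s' y - s y)
transfer (anon (just (var x)) (var y)) full b r cov (lift p) = lift disagree
  where
  move : ∀ a a' → a + (a' - a) ≡ a'
  move = solve-∀
  disagree : ∀ s' → _ → _
  disagree s' s'∈X' with cov .approx s'∈X'
  ... | s , s∈X , _ with s' y ℤ.≟ s y + (s' x - s x) | p s s∈X
  ... | no  sy≢ | _ =
    shift (s' x - s x) s , cov .shifts _ s∈X , cong just (sym (move (s x) (s' x))) , sy≢
  ... | yes sy≡ | t , t∈X , sx≡tx , sy≢ty =
    shift (s' x - s x) t , cov .shifts _ t∈X ,
    trans (cong just (sym (move (s x) (s' x)))) (cong (Maybe.map (_+ (s' x - s x))) sx≡tx) ,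
    λ e → sy≢ty (+-cancelʳ (s' x - s x) _ _ (trans (sym sy≡) e))
transfer (φ ∧' ψ) full b r cov (p , q) =
  transfer φ full (ℕ.m⊔n≤o⇒m≤o _ _ b) (ℕ.m⊔n≤o⇒m≤o _ _ r) cov p ,
  transfer ψ full (ℕ.m⊔n≤o⇒n≤o (bound φ) _ b) (ℕ.m⊔n≤o⇒n≤o (radius φ) _ r) cov q
transfer {N = N} {K} (φ ∨' ψ) {X' = X'} full b r cov (Y , Z , (X⊆Y∪Z , Y∪Z⊆X) , p , q) =
  image full N K Y X' , image full N K Z X' , (split , Sum.[ proj₁ , proj₁ ]) ,
  transfer φ full (ℕ.m⊔n≤o⇒m≤o _ _ b) (ℕ.m⊔n≤o⇒m≤o _ _ r)
    (Covers-image {Y = Y} full cov λ y → Y∪Z⊆X (inj₁ y)) p ,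
  transfer ψ full (ℕ.m⊔n≤o⇒n≤o (bound φ) _ b) (ℕ.m⊔n≤o⇒n≤o (radius φ) _ r)
    (Covers-image {Y = Z} full cov λ z → Y∪Z⊆X (inj₂ z)) q
  where
  split : ∀ {s'} → s' ∈ set X' → s' ∈ set (image full N K Y X') ⊎ s' ∈ set (image full N K Z X')
  split s'∈X' with cov .approx s'∈X'
  ... | s , s∈X , n = Sum.map (λ y → s'∈X' , s , y , n) (λ z → s'∈X' , s , z , n) (X⊆Y∪Z s∈X)
transfer (∃' v ψ) full b r cov (C , p) =
  image-choice full v cov' C ,
  transfer ψ (λ w → inj₁ (full w)) b ℕ.≤-refl (Covers-∃ full v cov' C) p
  where cov' = Covers-weaken r cov
transfer (∀' v ψ) full b r cov p =
  transfer ψ (λ w → inj₁ (full w)) b ℕ.≤-refl (Covers-∀ full v (Covers-weaken r cov)) p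


-- The formula θ on a single assignment.

module _ (s : Assignment ℤ) where

  T : Team ℤ U
  T = singleton s

  fixed : ∀ {t} → t ∈ set (T [M/ 2 ]) → t 0 ≡ s 0 × t 1 ≡ s 1
  fixed (r , _ , r≈s , t≈) = trans (t≈ 0 (inj₁ tt)) (r≈s 0 tt) , trans (t≈ 1 (inj₁ tt)) (r≈s 1 tt)

  module _ (odd : ∀ n → s 1 ≢ s 0 + (n + n)) where

    Edge : ℤ → ℤ → Set
    Edge u w = u ≡ w ⊎ u ≡ w + + 2

    -- Only x₂ = x₀ has to be in `aligned`; the whole coset x₀ + 2ℤ is taken to get closure under ±
    -- 2. Its overlap with `unequal` is harmless, since splits need not be disjoint.
    unequal aligned : Team ℤ (U ∪ ｛ 2 ｝)
    unequal = record
      { set  = λ t → t ∈ set (T [M/ 2 ]) × t 2 ≢ t 0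
      ; resp = λ e (t∈ , ≢) → resp (T [M/ 2 ]) e t∈ ,
          λ q → ≢ (trans (e 2 (inj₁ tt)) (trans q (sym (e 0 (inj₁ tt)))))
      }
    aligned = record
      { set  = λ t → t ∈ set (T [M/ 2 ]) × ∃[ n ] t 2 ≡ s 0 + (n + n)
      ; resp = λ e (t∈ , n , q) → resp (T [M/ 2 ]) e t∈ , n , trans (sym (e 2 (inj₁ tt))) q
      }

    -- The team (x₂, x₃) then runs through the bi-infinite path …, (a, a), (a + 2, a),
    -- (a + 2, a + 2), …, so every value of x₂ has two values of x₃ and conversely.
    edges : Choice aligned
    edges .H t m = Edge (t 2) m
    edges .H-resp _ e = Sum.map (trans (sym (e 2 (inj₁ tt)))) (trans (sym (e 2 (inj₁ tt))))
    edges .nonempty {t} _ = t 2 , inj₁ refl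

    path : Team ℤ ((U ∪ ｛ 2 ｝) ∪ ｛ 3 ｝)
    path = aligned [ edges /ᴴ 3 ]

    path-elim : ∀ {p} → p ∈ set path → (∃[ n ] p 2 ≡ s 0 + (n + n)) × Edge (p 2) (p 3) × p 1 ≡ s 1
    path-elim (t , m , (t∈ , n , q) , edge , e)
      rewrite e 1 (inj₁ (inj₁ tt)) | e 2 (inj₁ (inj₁ tt)) | e 3 (inj₁ (inj₁ tt)) =
      (n , q) , edge , proj₂ (fixed t∈)

    path-intro : ∀ n {u w} → u ≡ s 0 + (n + n) → Edge u w → ((s [ u / 2 ]) [ w / 3 ]) ∈ set path
    path-intro n {u} {w} q edge =
      s [ u / 2 ] , w , ((s , u , (λ _ _ → refl) , λ _ _ → refl) , n , q) , edge , λ _ _ → refl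

    i≢i+2 : ∀ i → i ≢ i + + 2
    i≢i+2 i e with +-cancelˡ i 0ℤ (+ 2) (trans (ℤ.+-identityʳ i) e)
    ... | ()

    two-ws : ∀ p → p ∈ set path → ∃[ p' ] p' ∈ set path × just (p 2) ≡ just (p' 2) × p 3 ≢ p' 3
    two-ws p p∈P with path-elim p∈P
    ... | (n , q) , inj₁ u≡w , _ =
      _ , path-intro n {w = p 2 - + 2} q (inj₂ (back (p 2))) , refl ,
      λ e → i≢i+2 (p 3) (trans (sym u≡w) (trans (back (p 2)) (cong (_+ + 2) (sym e))))
      where
      back : ∀ u → u ≡ (u - + 2) + + 2
      back = solve-∀
    ... | (n , q) , inj₂ u≡w+2 , _ =
      _ , path-intro n q (inj₁ refl) , refl , λ e → i≢i+2 (p 3) (trans e u≡w+2)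

    two-us : ∀ p → p ∈ set path → ∃[ p' ] p' ∈ set path × just (p 3) ≡ just (p' 3) × p 2 ≢ p' 2
    two-us p p∈P with path-elim p∈P
    ... | (n , q) , inj₁ u≡w , _ =
      _ , path-intro (n + + 1) (trans (cong (_+ + 2) q) (next (s 0) n)) (inj₂ (cong (_+ + 2) u≡w)) ,
      refl , i≢i+2 (p 2)
      where
      next : ∀ a n → (a + (n + n)) + + 2 ≡ a + ((n + + 1) + (n + + 1))
      next = solve-∀
    ... | (n , q) , inj₂ u≡w+2 , _ =
      _ , path-intro (n - + 1) (trans (back (p 3)) (trans (cong (_- + 2) (trans (sym u≡w+2) q)) (prev (s 0) n)))
        (inj₁ refl) , refl ,
      λ e → i≢i+2 (p 3) (trans (sym e) u≡w+2)
      where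
      back : ∀ w → w ≡ (w + + 2) - + 2
      back = solve-∀
      prev : ∀ a n → (a + (n + n)) - + 2 ≡ a + ((n - + 1) + (n - + 1))
      prev = solve-∀

    diagonal step : Team ℤ ((U ∪ ｛ 2 ｝) ∪ ｛ 3 ｝)
    diagonal = record
      { set  = λ p → p ∈ set path × p 2 ≡ p 3
      ; resp = λ e (p∈ , q) → resp path e p∈ ,
          trans (sym (e 2 (inj₁ (inj₁ tt)))) (trans q (e 3 (inj₁ (inj₁ tt))))
      }
    step = record
      { set  = λ p → p ∈ set path × p 2 ≡ p 3 + + 2
      ; resp = λ e (p∈ , q) → resp path e p∈ ,
          trans (sym (e 2 (inj₁ (inj₁ tt)))) (trans q (cong (_+ + 2) (e 3 (inj₁ (inj₁ tt)))))
      }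

    θ-odd : +2-graph ⊨[ T ] θ
    θ-odd =
      unequal , aligned , (cover , Sum.[ proj₁ , proj₁ ]) , lift (λ _ → proj₂) ,
      edges , lift two-ws , lift two-us ,
      lift (λ p p∈P e → let ((n , q) , _ , p1≡s1) = path-elim p∈P in
                        odd n (trans (sym p1≡s1) (trans (sym e) q))) ,
      diagonal , step ,
      ((λ p∈P → Sum.map (p∈P ,_) (p∈P ,_) (proj₁ (proj₂ (path-elim p∈P)))) , Sum.[ proj₁ , proj₁ ]) ,
      lift (λ _ → proj₂) , lift (λ _ → proj₂)
      where
      a≡a+0 : ∀ a → a ≡ a + (0ℤ + 0ℤ)
      a≡a+0 = solve-∀
      cover : ∀ {t} → t ∈ set (T [M/ 2 ]) → t ∈ set unequal ⊎ t ∈ set aligned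
      cover {t} t∈ with t 2 ℤ.≟ t 0
      ... | no  ≢ = inj₁ (t∈ , ≢)
      ... | yes e = inj₂ (t∈ , 0ℤ , trans e (trans (proj₁ (fixed t∈)) (a≡a+0 (s 0))))

  -- In any witnessing team x₂ takes the value x₀ and, with each value, the one 2 higher, so it
  -- reaches x₁ after B steps. Non-negative even distances suffice for the final pair.
  ¬θ-even : ∀ B → s 1 ≡ s 0 + (+ B + + B) → ¬ (+2-graph ⊨[ T ] θ)
  ¬θ-even B s1≡ (Y , Z , (T⊆Y∪Z , Y∪Z⊆T) , lift u≢x₀ , C , lift two-ws , lift two-us , lift u≢x₁ ,
                 D₁ , D₂ , (P⊆D₁∪D₂ , _) , lift d₁ , lift d₂) = contra (reach B)
    where
    P = Z [ C /ᴴ 3 ]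

    edge : ∀ {p} → p ∈ set P → p 2 ≡ p 3 ⊎ p 2 ≡ p 3 + + 2
    edge {p} p∈P = Sum.map (d₁ p) (d₂ p) (P⊆D₁∪D₂ p∈P)

    -- Over a fixed x₂ only x₂ and x₂ - 2 are possible for x₃, so two distinct values include x₂.
    diagonal-at : ∀ {p} → p ∈ set P → ∃[ q ] q ∈ set P × q 2 ≡ p 2 × q 2 ≡ q 3
    diagonal-at {p} p∈P with edge p∈P | two-ws p p∈P
    ... | inj₁ e | _ = p , p∈P , refl , e
    ... | inj₂ e | q , q∈P , p2≡q2 , p3≢q3 with edge q∈P
    ...   | inj₁ e' = q , q∈P , sym (just-injective p2≡q2) , e'
    ...   | inj₂ e' = contradiction (+-cancelʳ (+ 2) _ _ (trans (sym e) (trans (just-injective p2≡q2) e')))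
                        p3≢q3

    -- Starting from x₂ = x₃, the second value of x₂ over this x₃ can only be x₃ + 2.
    advance : ∀ {p} → p ∈ set P → ∃[ q ] q ∈ set P × q 2 ≡ p 2 + + 2
    advance p∈P with diagonal-at p∈P
    ... | q , q∈P , q2≡p2 , q2≡q3 with two-us q q∈P
    ... | r , r∈P , q3≡r3 , q2≢r2 with edge r∈P
    ... | inj₁ e = contradiction (trans q2≡q3 (trans (just-injective q3≡r3) (sym e))) q2≢r2
    ... | inj₂ e = r , r∈P , trans e
      (cong (_+ + 2) (trans (sym (just-injective q3≡r3)) (trans (sym q2≡q3) q2≡p2)))

    reach : ∀ n → ∃[ p ] p ∈ set P × p 2 ≡ s 0 + (+ n + + n)
    reach zero with T⊆Y∪Z {s [ s 0 / 2 ]} (s , s 0 , (λ _ _ → refl) , λ _ _ → refl)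
    ... | inj₁ t∈Y = contradiction refl (u≢x₀ _ t∈Y)
    ... | inj₂ t∈Z with nonempty C t∈Z
    ... | m , m∈H = (s [ s 0 / 2 ]) [ m / 3 ] ,
      (_ , m , t∈Z , m∈H , λ _ _ → refl) , sym (ℤ.+-identityʳ (s 0))
    reach (suc n) with reach n
    ... | p , p∈P , p2≡ with advance p∈P
    ... | q , q∈P , q2≡ = q , q∈P , trans q2≡ (trans (cong (_+ + 2) p2≡) (next (s 0) (+ n)))
      where
      next : ∀ a n → (a + (n + n)) + + 2 ≡ a + ((+ 1 + n) + (+ 1 + n))
      next = solve-∀

    contra : ∃[ p ] p ∈ set P × p 2 ≡ s 0 + (+ B + + B) → ⊥
    contra (p , p∈P@(t , m , t∈Z , _ , e) , p2≡) = u≢x₁ p p∈P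
      (trans p2≡ (trans (sym s1≡) (sym (trans (e 1 (inj₁ (inj₁ tt))) (proj₂ (fixed (Y∪Z⊆T (inj₂ t∈Z))))))))

-- The two teams and the conclusion.

odd-pairs : Team ℤ U
odd-pairs = record
  { set  = λ s → ∀ n → s 1 ≢ s 0 + (n + n)
  ; resp = λ e odd n q → odd n (trans (e 1 tt) (trans q (cong (_+ (n + n)) (sym (e 0 tt)))))
  }

near-odd-pairs : ℕ → ℕ → Team ℤ U
near-odd-pairs N K = record
  { set  = λ s' → ∃[ s ] s ∈ set odd-pairs × Near N K s s'
  ; resp = λ { e (s , s∈ , n) → s , s∈ , Near-respʳ (λ v → e v tt) n }
  }

covers-odd-pairs : ∀ N K → Covers N K odd-pairs (near-odd-pairs N K)
covers-odd-pairs N K .approx s'∈ = s'∈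
covers-odd-pairs N K .shifts {s} c s∈ = s , s∈ , Near-shift s c

origin : Assignment ℤ
origin _ = 0ℤ

-- Apart from 0, the only differences are m and m' up to sign, all beyond K.
Near-far : ∀ {N K m m'} → K < ∣ m ∣ → K < ∣ m' ∣ → Near N K (origin [ m / 1 ]) (origin [ m' / 1 ])
Near-far {N} {K} {m} {m'} f f' = Near-update {s = origin} {origin} 1 (near λ _ _ _ → refl) λ _ → λ
  { (inj₁ p) → contradiction (subst (λ z → ∣ z ∣ ≤ K) (ℤ.+-identityʳ m) p) (ℕ.<⇒≱ f)
  ; (inj₂ p) → contradiction (subst (λ z → ∣ z ∣ ≤ K) (ℤ.+-identityʳ m') p) (ℕ.<⇒≱ f') }

1+m+m≢n+n : ∀ m n → suc (m ℕ.+ m) ≢ n ℕ.+ n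
1+m+m≢n+n m n e = ℕ.even≢odd n m (trans (double n) (trans (sym e) (cong suc (sym (double m)))))
  where
  double : ∀ k → 2 ℕ.* k ≡ k ℕ.+ k
  double k = cong (k ℕ.+_) (ℕ.+-identityʳ k)

odd-witness : ∀ K → origin [ + suc (K ℕ.+ K) / 1 ] ∈ set odd-pairs
odd-witness K (+ n)    e = 1+m+m≢n+n K n (ℤ.+-injective (trans e (ℤ.+-identityˡ _)))
odd-witness K -[1+ n ] e with trans e (ℤ.+-identityˡ (-[1+ n ] + -[1+ n ]))
... | ()

corollary5p8 : Σ[ σ ∈ Signature ] Σ[ φ ∈ Formula σ FO[Υ₁,F] ]
    ((ψ : Formula σ FO[Υ₁]) → ¬ Equivalent φ ψ)
corollary5p8 = σ , flat θ , λ ψ equiv →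
  let N = bound ψ
      K = radius ψ
      φ⇔ψ = λ X → equiv +2-graph U (λ _ → tt) (λ _ → tt) X
      ψ-near = transfer ψ (λ _ → tt) ℕ.≤-refl ℕ.≤-refl (covers-odd-pairs N K)
                 (Equivalence.to (φ⇔ψ odd-pairs) λ s odd → θ-odd s odd)
  -- The distances 2K + 1 and 2K + 2 both exceed K but differ in parity, so the larger team contains
  -- a pair at even distance.
  in ¬θ-even (origin [ + (suc K ℕ.+ suc K) / 1 ]) (suc K) refl
       (Equivalence.from (φ⇔ψ (near-odd-pairs N K)) ψ-near _
         (_ , odd-witness K , Near-far (ℕ.s≤s (ℕ.m≤m+n K K)) (ℕ.m≤m+n (suc K) (suc K))))
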